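{- Let $G$ and $H$ be graphs such that $H$ is not isomorphic to the one-vertex graph $K_1$, and let $n$ be the order (number of vertices) of $G$. Then $\gamma_I(G\odot H)=2n$.
   Context: All graphs are finite, simple, undirected and have nonempty vertex set. $N(v)$ denotes the open neighborhood of a vertex $v$. An Italian dominating function (IDF) of a graph $G$ is a function $f:V(G)\to\{0,1,2\}$ such that every $v\in V(G)$ with $f(v)=0$ satisfies $\sum_{u\in N(v)}f(u)\ge 2$. Its weight is $\sum_{v\in V(G)}f(v)$, and the Italian domination number $\gamma_I(G)$ is the minimum weight of an IDF of $G$. The corona $G\odot H$ of graphs $G$ and $H$ is obtained from one copy of $G$ and $|V(G)|$ disjoint copies of $H$ by joining the $i$-th vertex of $G$ to every vertex of the $i$-th copy of $H$. -}

module Defs where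

open import Data.Empty using (⊥)
open import Data.Fin.Base using (Fin; zero; suc; toℕ; finToFun; funToFin)
open import Data.Fin.Properties as Fin
  using (+↔⊎; *↔×; finToFun-funToFin)
open import Data.List.Base using (List; tabulate; map; filter)
open import Data.List.Properties using (map-cong)
open import Data.Nat.Base
open import Data.Nat.ListAction using (sum)
open import Data.Nat.Induction using (Acc; acc; <-wellFounded)
open import Data.Nat.Properties as ℕ using (_≤?_; _<?_; ≮⇒≥; ≤-reflexive; ≤-trans)
open import Data.Product.Base using (∃-syntax; _×_; _,_; proj₁)
open import Data.Product.Function.NonDependent.Propositional using (_×-↔_)
open import Data.Sum.Base using (_⊎_; inj₁; inj₂)
open import Data.Sum.Function.Propositional using (_⊎-↔_)
open import Function.Base using (_∘_)
open import Function.Bundles using (_↔_; _⇔_; Inverse)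
open import Function.Construct.Composition using (_↔-∘_)
open import Function.Construct.Identity using (↔-id)
open import Function.Construct.Symmetry using (↔-sym)
open import Function.Properties.Inverse using (↔⇒↣)
open import Level using (0ℓ)
open import Relation.Binary.Core using (Rel)
open import Relation.Binary.Definitions
  using (Decidable; DecidableEquality; Symmetric; Irreflexive)
open import Relation.Binary.PropositionalEquality
  using (_≡_; refl; sym; trans; cong; subst)
open import Relation.Nullary.Decidable
  using (Dec; yes; no; _×-dec_; _→-dec_; map′)

record Graph : Set₁ where
  field
    V        : Set
    order    : ℕ
    enum     : Fin order ↔ V
    nonempty : NonZero order
    Adj      : Rel V 0ℓ
    adj?     : Decidable Adj
    adj-sym  : Symmetric Adj
    adj-irr  : Irreflexive _≡_ Adj

  _≟_ : DecidableEquality V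
  _≟_ = Fin.inj⇒≟ (↔⇒↣ (↔-sym enum))

  vertices : List V
  vertices = tabulate (Inverse.to enum)

  N : V → List V
  N v = filter (adj? v) vertices

record _≅_ (G H : Graph) : Set where
  field
    bij     : Graph.V G ↔ Graph.V H
    adj-iff : ∀ u v → Graph.Adj G u v
                    ⇔ Graph.Adj H (Inverse.to bij u) (Inverse.to bij v)

K₁ : Graph
K₁ = record
  { V        = Fin 1
  ; order    = 1
  ; enum     = ↔-id _
  ; nonempty = _
  ; Adj      = λ _ _ → ⊥
  ; adj?     = λ _ _ → no λ ()
  ; adj-sym  = λ ()
  ; adj-irr  = λ _ ()
  }

-- inj₁ u is the vertex u of G; inj₂ (u , x) is the vertex x of the copy of H
-- attached to u.
module Corona (G H : Graph) where
  private
    module G = Graph G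
    module H = Graph H

  V : Set
  V = G.V ⊎ (G.V × H.V)

  Adj : Rel V 0ℓ
  Adj (inj₁ u)       (inj₁ v)       = G.Adj u v
  Adj (inj₁ u)       (inj₂ (v , _)) = u ≡ v
  Adj (inj₂ (u , _)) (inj₁ v)       = u ≡ v
  Adj (inj₂ (u , x)) (inj₂ (v , y)) = u ≡ v × H.Adj x y

  adj? : Decidable Adj
  adj? (inj₁ u)       (inj₁ v)       = G.adj? u v
  adj? (inj₁ u)       (inj₂ (v , _)) = u G.≟ v
  adj? (inj₂ (u , _)) (inj₁ v)       = u G.≟ v
  adj? (inj₂ (u , x)) (inj₂ (v , y)) = u G.≟ v ×-dec H.adj? x y

  adj-sym : Symmetric Adj
  adj-sym {inj₁ _} {inj₁ _} a       = G.adj-sym a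
  adj-sym {inj₁ _} {inj₂ _} e       = sym e
  adj-sym {inj₂ _} {inj₁ _} e       = sym e
  adj-sym {inj₂ _} {inj₂ _} (e , a) = sym e , H.adj-sym a

  adj-irr : Irreflexive _≡_ Adj
  adj-irr {inj₁ _} refl a       = G.adj-irr refl a
  adj-irr {inj₂ _} refl (_ , a) = H.adj-irr refl a

  order : ℕ
  order = G.order + G.order * H.order

  enum : Fin order ↔ V
  enum = (G.enum ⊎-↔ ((G.enum ×-↔ H.enum) ↔-∘ *↔×)) ↔-∘ +↔⊎

  nonempty : NonZero order
  nonempty = >-nonZero
    (ℕ.≤-trans (>-nonZero⁻¹ G.order {{G.nonempty}}) (ℕ.m≤m+n _ _))

_⊙_ : Graph → Graph → Graph
G ⊙ H = record
  { V        = V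
  ; order    = order
  ; enum     = enum
  ; nonempty = nonempty
  ; Adj      = Adj
  ; adj?     = adj?
  ; adj-sym  = λ {x} {y} → adj-sym {x} {y}
  ; adj-irr  = λ {x} {y} → adj-irr {x} {y}
  }
  where open Corona G H

open Graph using (V; order)

module _ (G : Graph) where
  open Graph G using (vertices; N; enum)

  -- A map V G → Fin 3 is read through toℕ as a {0,1,2}-valued function.
  weight : (V G → Fin 3) → ℕ
  weight f = sum (map (toℕ ∘ f) vertices)

  IsIDF : (V G → Fin 3) → Set
  IsIDF f = ∀ v → toℕ (f v) ≡ 0 → 2 ≤ sum (map (toℕ ∘ f) (N v))

  IsMinimumIDF : (V G → Fin 3) → Set
  IsMinimumIDF f = IsIDF f × (∀ g → IsIDF g → weight f ≤ weight g)

  private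
    open Inverse enum using (to; from; strictlyInverseˡ)

    isIDF? : ∀ f → Dec (IsIDF f)
    isIDF? f = map′
      (λ p v → subst (λ w → toℕ (f w) ≡ 0 → 2 ≤ sum (map (toℕ ∘ f) (N w)))
                     (strictlyInverseˡ v) (p (from v)))
      (λ p i → p (to i))
      (Fin.all? λ i → (toℕ (f (to i)) ℕ.≟ 0) →-dec (2 ≤? _))

    module _ {f g : V G → Fin 3} (f≗g : ∀ v → f v ≡ g v) where
      sum-ext : ∀ vs → sum (map (toℕ ∘ f) vs) ≡ sum (map (toℕ ∘ g) vs)
      sum-ext vs = cong sum (map-cong (cong toℕ ∘ f≗g) vs)

      isIDF-ext : IsIDF f → IsIDF g
      isIDF-ext p v gv≡0 = ≤-trans (p v (trans (cong toℕ (f≗g v)) gv≡0))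
                                   (≤-reflexive (sum-ext (N v)))

    decode : Fin (3 ^ order G) → V G → Fin 3
    decode c = finToFun c ∘ from

    encode : (V G → Fin 3) → Fin (3 ^ order G)
    encode f = funToFin (f ∘ to)

    decode-encode : ∀ f v → f v ≡ decode (encode f) v
    decode-encode f v = sym (trans (finToFun-funToFin (f ∘ to) (from v))
                                   (cong f (strictlyInverseˡ v)))

    descend : ∀ f → IsIDF f → Acc _<_ (weight f) → ∃[ g ] IsMinimumIDF g
    descend f p (acc rs)
      with Fin.any? (λ c → isIDF? (decode c) ×-dec (weight (decode c) <? weight f))
    ... | yes (c , q , lt) = descend (decode c) q (rs lt)
    ... | no ¬smaller = f , p , λ g q → ≮⇒≥ λ lt → ¬smaller
      ( encode g , isIDF-ext (decode-encode g) q
      , subst (_< weight f) (sum-ext (decode-encode g) vertices) lt )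

  -- Starting from the constant 2, pass to a lighter IDF for as long as one
  -- exists.  Which minimum is reached is immaterial: they all have equal weight.
  minimumIDF : ∃[ f ] IsMinimumIDF f
  minimumIDF = descend (λ _ → suc (suc zero)) (λ _ ()) (<-wellFounded _)

  γI : ℕ
  γI = weight (proj₁ minimumIDF)

{-# OPTIONS --safe #-}

-- Cut the corona into blocks, a block being a vertex u of G together with its
-- copy of H.  Every vertex (u , x) of the copy has its whole neighbourhood in
-- the block, so the block weighs at least 2 as soon as some (u , x) gets value
-- 0; otherwise two vertices of the copy weigh at least 1 each.  Conversely, the
-- value 2 on G and 0 elsewhere defines an IDF of weight 2n.
module Submission where

open import Defs
open import Data.Empty using (⊥-elim)
open import Data.Fin.Base using (Fin; zero; suc; toℕ)
open import Data.List.Base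
  using (List; []; _∷_; [_]; _++_; map; concatMap; length)
open import Data.List.Membership.Propositional using (_∈_)
open import Data.List.Membership.Propositional.Properties
  using (∈-∃++; ∈-map⁺; ∈-map⁻; ∈-tabulate⁺; ∈-filter⁺; ∈-filter⁻; ∈-concatMap⁺)
open import Data.List.Properties using (map-++; length-tabulate; map-∘)
open import Data.List.Relation.Binary.Disjoint.Propositional using (Disjoint)
open import Data.List.Relation.Binary.Permutation.Propositional using (_↭_)
open import Data.List.Relation.Binary.Permutation.Propositional.Properties
  using (shift; ∈-resp-↭; map⁺)
open import Data.List.Relation.Binary.Subset.Propositional using (_⊆_)
open import Data.List.Relation.Binary.Subset.Propositional.Properties
  using (⊆∷∧∉⇒⊆) renaming (map⁺ to map⁺-⊆)
open import Data.List.Relation.Unary.All as All using ([]; _∷_)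
import Data.List.Relation.Unary.All.Properties as All
open import Data.List.Relation.Unary.AllPairs as AllPairs using ([]; _∷_)
import Data.List.Relation.Unary.AllPairs.Properties as AllPairs
open import Data.List.Relation.Unary.Any as Any using (here; there)
open import Data.List.Relation.Unary.Unique.Propositional using (Unique)
import Data.List.Relation.Unary.Unique.Propositional.Properties as Unique
open import Data.Nat.Base using (ℕ; suc; _+_; _*_; _≤_; z≤n; NonZero)
open import Data.Nat.ListAction using (sum)
open import Data.Nat.ListAction.Properties using (sum-++; sum-↭)
open import Data.Nat.Properties
  using (≤-reflexive; ≤-trans; ≤-antisym; +-monoʳ-≤; +-mono-≤;
         m≤m+n; *-comm; n≢0⇒n>0; _≟_; module ≤-Reasoning)
open import Data.Product.Base using (_,_; proj₂; ∃₂)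
open import Data.Product.Properties using (,-injectiveʳ)
open import Data.Sum.Base using (inj₁; inj₂)
open import Data.Sum.Properties using (inj₂-injective)
open import Function.Base using (_∘_)
open import Function.Bundles using (_↔_; Inverse; Injection; mk⇔)
open import Function.Construct.Symmetry using (↔-sym)
open import Function.Properties.Inverse using (↔⇒↣)
open import Relation.Binary.PropositionalEquality
  using (_≡_; _≢_; refl; sym; trans; cong; subst)
open import Relation.Nullary.Decidable using (yes; no)
open import Relation.Nullary.Negation.Core using (¬_)

-- Sums of weights over lists

module _ {A : Set} (w : A → ℕ) where

  -- By induction on `xs`: delete one occurrence of the head `x` from `ys`. As `x` does not recur in
  -- the tail, the tail is still contained in what remains. All comparisons between neighbourhoods,
  -- blocks and the whole vertex set go through this.
  sum-⊆ : ∀ {xs ys} → Unique xs → xs ⊆ ys → sum (map w xs) ≤ sum (map w ys)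
  sum-⊆ {[]} _ _ = z≤n
  sum-⊆ {x ∷ xs} {ys} xs!@(_ ∷ xs′!) xs⊆ys
    with as , bs , refl ← ∈-∃++ (xs⊆ys (here refl)) = begin
      w x + sum (map w xs)          ≤⟨ +-monoʳ-≤ (w x) (sum-⊆ xs′! xs⊆as++bs) ⟩
      sum (map w (x ∷ as ++ bs))    ≡⟨ sum-↭ (map⁺ w ys↭) ⟨
      sum (map w (as ++ [ x ] ++ bs)) ∎
    where
    open ≤-Reasoning
    ys↭ : as ++ [ x ] ++ bs ↭ x ∷ as ++ bs
    ys↭ = shift x as bs
    xs⊆as++bs : xs ⊆ as ++ bs
    xs⊆as++bs = ⊆∷∧∉⇒⊆ (∈-resp-↭ ys↭ ∘ xs⊆ys ∘ there)
                       (Unique.Unique[x∷xs]⇒x∉xs xs!)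

  module _ {I : Set} (block : I → List A) where

    sum-concatMap-∷ : ∀ i is → sum (map w (concatMap block (i ∷ is)))
                             ≡ sum (map w (block i)) + sum (map w (concatMap block is))
    sum-concatMap-∷ i is = trans (cong sum (map-++ w (block i) _))
                                 (sum-++ (map w (block i)) _)

    sum-concatMap-≥ : ∀ {c} → (∀ i → c ≤ sum (map w (block i))) →
                      ∀ is → length is * c ≤ sum (map w (concatMap block is))
    sum-concatMap-≥ c≤ []       = z≤n
    sum-concatMap-≥ c≤ (i ∷ is) = ≤-trans
      (+-mono-≤ (c≤ i) (sum-concatMap-≥ c≤ is))
      (≤-reflexive (sym (sum-concatMap-∷ i is)))

    sum-concatMap-≤ : ∀ {c} → (∀ i → sum (map w (block i)) ≤ c) →
                      ∀ is → sum (map w (concatMap block is)) ≤ length is * c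
    sum-concatMap-≤ ≤c []       = z≤n
    sum-concatMap-≤ ≤c (i ∷ is) = ≤-trans
      (≤-reflexive (sum-concatMap-∷ i is))
      (+-mono-≤ (≤c i) (sum-concatMap-≤ ≤c is))

sum-map-zero : ∀ {A : Set} (xs : List A) → sum (map (λ _ → 0) xs) ≡ 0
sum-map-zero []       = refl
sum-map-zero (_ ∷ xs) = sum-map-zero xs

-- Vertex lists, neighbourhoods and graphs of order 1

module _ (G : Graph) where
  open Graph G

  vertices-unique : Unique vertices
  vertices-unique = Unique.tabulate⁺ (Injection.injective (↔⇒↣ enum))

  ∈-vertices : ∀ v → v ∈ vertices
  ∈-vertices v = subst (_∈ vertices) (Inverse.strictlyInverseˡ enum v)
                       (∈-tabulate⁺ (Inverse.from enum v))

  N-unique : ∀ v → Unique (N v)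
  N-unique v = Unique.filter⁺ (adj? v) vertices-unique

  ∈-N⁺ : ∀ {u v} → Adj u v → v ∈ N u
  ∈-N⁺ {u} {v} = ∈-filter⁺ (adj? u) (∈-vertices v)

  ∈-N⁻ : ∀ {u v} → v ∈ N u → Adj u v
  ∈-N⁻ {u} = proj₂ ∘ ∈-filter⁻ (adj? u) {xs = vertices}

  order-1⇒≅K₁ : Fin 1 ↔ V → G ≅ K₁
  order-1⇒≅K₁ e = record
    { bij     = ↔-sym e
    -- Both adjacency relations are empty: any two vertices of `G` coincide and `Adj` is
    -- irreflexive.
    ; adj-iff = λ u v → mk⇔ (adj-irr (all-equal u v)) λ ()
    }
    where
    Fin1-prop : (i j : Fin 1) → i ≡ j
    Fin1-prop zero zero = refl
    all-equal : ∀ u v → u ≡ v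
    all-equal u v = Injection.injective (↔⇒↣ (↔-sym e)) (Fin1-prop _ _)

  two-vertices : ¬ (G ≅ K₁) → ∃₂ λ (x y : V) → x ≢ y
  two-vertices G≇K₁ = go order enum nonempty
    where
    -- The order becomes a variable `n`, so that it can be split together with the enumeration;
    -- `NonZero n` excludes `n = 0`.
    go : ∀ n → Fin n ↔ V → NonZero n → ∃₂ λ (x y : V) → x ≢ y
    go 1             e _ = ⊥-elim (G≇K₁ (order-1⇒≅K₁ e))
    go (suc (suc n)) e _ = Inverse.to e zero , Inverse.to e (suc zero) ,
      λ eq → case0≢1 (Injection.injective (↔⇒↣ e) eq)
      where
      case0≢1 : zero ≢ suc {n = suc n} zero
      case0≢1 ()

-- The block decomposition of the corona

module _ (G H : Graph) where
  private
    module G = Graph G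
    module H = Graph H
    module C = Graph (G ⊙ H)

  block : G.V → List C.V
  block u = inj₁ u ∷ map (inj₂ ∘ (u ,_)) H.vertices

  -- A rearrangement of `vertices (G ⊙ H)`, which lists all of `G` before the copies of `H`. Here
  -- the vertices are grouped by root, so that the weight splits into block weights.
  blocks : List C.V
  blocks = concatMap block G.vertices

  root : C.V → G.V
  root (inj₁ u)       = u
  root (inj₂ (u , _)) = u

  ∈-block⁺ : ∀ v → v ∈ block (root v)
  ∈-block⁺ (inj₁ u)       = here refl
  ∈-block⁺ (inj₂ (u , x)) = there (∈-map⁺ _ (∈-vertices H x))

  -- Each member determines its block, which makes distinct blocks disjoint.
  ∈-block⁻ : ∀ {u v} → v ∈ block u → root v ≡ u
  ∈-block⁻ (here refl) = refl
  ∈-block⁻ (there v∈) with _ , _ , refl ← ∈-map⁻ _ v∈ = refl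

  block-unique : ∀ u → Unique (block u)
  block-unique u = All.map⁺ (All.universal (λ _ ()) H.vertices)
    ∷ Unique.map⁺ (λ { refl → refl }) (vertices-unique H)

  blocks-unique : Unique blocks
  blocks-unique = Unique.concat⁺
    (All.map⁺ (All.universal block-unique G.vertices))
    (AllPairs.map⁺ (AllPairs.map
      block-disjoint (vertices-unique G)))
    where
    block-disjoint : ∀ {u v} → u ≢ v → Disjoint (block u) (block v)
    block-disjoint u≢v (∈u , ∈v) = u≢v (trans (sym (∈-block⁻ ∈u)) (∈-block⁻ ∈v))

  ∈-blocks : ∀ v → v ∈ blocks
  ∈-blocks v = ∈-concatMap⁺ block
    (Any.map (λ { refl → ∈-block⁺ v }) (∈-vertices G (root v)))

  -- Both clauses of the corona adjacency at a copy vertex include an equation between roots.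
  N⊆block : ∀ u x → C.N (inj₂ (u , x)) ⊆ block u
  N⊆block u x {v} v∈N = subst (λ r → v ∈ block r)
    (root≡u v (∈-N⁻ (G ⊙ H) {inj₂ (u , x)} v∈N)) (∈-block⁺ v)
    where
    root≡u : ∀ v → C.Adj (inj₂ (u , x)) v → root v ≡ u
    root≡u (inj₁ _) u≡v       = sym u≡v
    root≡u (inj₂ _) (u≡v , _) = sym u≡v

  length-vertices*2 : length G.vertices * 2 ≡ 2 * G.order
  length-vertices*2 = trans (cong (_* 2) (length-tabulate (Inverse.to G.enum)))
                            (*-comm G.order 2)

  -- Lower bound

  block-weight-≥2 : ∀ {x y} → x ≢ y → ∀ f → IsIDF (G ⊙ H) f →
                    ∀ u → 2 ≤ sum (map (toℕ ∘ f) (block u))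
  block-weight-≥2 {x} {y} x≢y f idf u
    with toℕ (f (inj₂ (u , x))) ≟ 0 | toℕ (f (inj₂ (u , y))) ≟ 0
  ... | yes fx≡0 | _ = ≤-trans (idf _ fx≡0)
    (sum-⊆ _ (N-unique (G ⊙ H) (inj₂ (u , x))) (N⊆block u x))
  ... | no _ | yes fy≡0 = ≤-trans (idf _ fy≡0)
    (sum-⊆ _ (N-unique (G ⊙ H) (inj₂ (u , y))) (N⊆block u y))
  -- The two-element list of `(u , x)` and `(u , y)` is duplicate-free and lies in the block;
  -- `m≤m+n _ 0` absorbs the final `+ 0` of its sum.
  ... | no fx≢0 | no fy≢0 = ≤-trans
    (+-mono-≤ (n≢0⇒n>0 fx≢0) (≤-trans (n≢0⇒n>0 fy≢0) (m≤m+n _ 0)))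
    (sum-⊆ _
             (Unique.map⁺ (,-injectiveʳ ∘ inj₂-injective) ((x≢y ∷ []) ∷ [] ∷ []))
             (there ∘ map⁺-⊆ _ (λ {z} _ → ∈-vertices H z)))

  weight-≥ : ¬ (H ≅ K₁) → ∀ f → IsIDF (G ⊙ H) f → 2 * G.order ≤ weight (G ⊙ H) f
  weight-≥ H≇K₁ f idf with _ , _ , x≢y ← two-vertices H H≇K₁ = begin
    2 * G.order                ≡⟨ length-vertices*2 ⟨
    length G.vertices * 2      ≤⟨ sum-concatMap-≥ _ block
                                    (block-weight-≥2 x≢y f idf) G.vertices ⟩
    sum (map (toℕ ∘ f) blocks) ≤⟨ sum-⊆ _ blocks-unique (λ {v} _ → ∈-vertices (G ⊙ H) v) ⟩
    weight (G ⊙ H) f           ∎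
    where open ≤-Reasoning

  -- Upper bound

  two-on-G : C.V → Fin 3
  two-on-G (inj₁ _) = suc (suc zero)
  two-on-G (inj₂ _) = zero

  two-on-G-isIDF : IsIDF (G ⊙ H) two-on-G
  -- Only copy vertices have value 0, and the neighbour `inj₁ u` alone contributes the required 2.
  two-on-G-isIDF (inj₂ (u , x)) _ = sum-⊆ (toℕ ∘ two-on-G) {[ inj₁ u ]} ([] ∷ [])
    λ { (here refl) → ∈-N⁺ (G ⊙ H) {inj₂ (u , x)} refl }

  two-on-G-block-weight : ∀ u → sum (map (toℕ ∘ two-on-G) (block u)) ≡ 2
  two-on-G-block-weight u = cong (2 +_) (trans
    -- Once the two maps are fused, the summand reduces to the constant 0.
    (cong sum (sym (map-∘ H.vertices)))
    (sum-map-zero H.vertices))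

  two-on-G-weight-≤ : weight (G ⊙ H) two-on-G ≤ 2 * G.order
  two-on-G-weight-≤ = begin
    weight (G ⊙ H) two-on-G           ≤⟨ sum-⊆ _ (vertices-unique (G ⊙ H))
                                                 (λ {v} _ → ∈-blocks v) ⟩
    sum (map (toℕ ∘ two-on-G) blocks) ≤⟨ sum-concatMap-≤ _ block
                                           (≤-reflexive ∘ two-on-G-block-weight) G.vertices ⟩
    length G.vertices * 2             ≡⟨ length-vertices*2 ⟩
    2 * G.order                       ∎
    where open ≤-Reasoning

theorem2p2 : (G H : Graph) → ¬ (H ≅ K₁) → γI (G ⊙ H) ≡ 2 * Graph.order G
-- Minimality against `two-on-G` gives the upper bound; the lower bound uses only that the minimum
-- is itself an IDF.
theorem2p2 G H H≇K₁ with _ , idf , minimal ← minimumIDF (G ⊙ H) = ≤-antisym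
  (≤-trans (minimal (two-on-G G H) (two-on-G-isIDF G H)) (two-on-G-weight-≤ G H))
  (weight-≥ G H H≇K₁ _ idf)
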